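{- \textsc{Short Choice} is a total search problem: for every $n\ge 2$ and every instance (universe $U$ with $|U|=2^n-2$ and predicates $P_0,\dots,P_{n-2}$), a solution exists.
   Context: \textsc{Short Choice}: The universe $U$ is a set of $2^n-2$ objects, each represented by a distinct $n$-bit string. The input is a sequence of predicates $P_0,\dots,P_{n-2}$ given by poly($n$)-size circuits, with $P_i:U^{i+2}\to\{0,1\}$. A Long Choice subcertificate is a sequence of distinct elements $a_0,\dots,a_k\in U$ such that for every $i$ with $0\le i<k$ and every $j$ with $i<j\le k$, $P_i(a_0,\dots,a_i,a_j)=P_i(a_0,\dots,a_i,a_{i+1})$. An element $x\in U\setminus\{a_0,\dots,a_k\}$ extends the subcertificate if $a_0,\dots,a_k,x$ is again a Long Choice subcertificate. A solution of \textsc{Short Choice} consists of an integer $k$ with $0\le k\le n-2$, a Long Choice subcertificate $a_0,\dots,a_k$, and a bit $c\in\{0,1\}$ such that there is no $x$ extending $a_0,\dots,a_k$ with $P_k(a_0,\dots,a_k,x)=c$. -}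

module Defs where

open import Data.Bool.Base using (Bool)
open import Data.Fin.Base using (Fin; toℕ; fromℕ<)
open import Data.Nat.Base using (ℕ; suc; _+_; _∸_; _^_; _<_; s≤s)
open import Data.Nat.Properties using (≤-trans; <⇒≤)
open import Data.Product.Base using (_×_; ∃-syntax)
open import Data.Vec.Base using (Vec; lookup; truncate; _∷ʳ_)
open import Data.Vec.Membership.Propositional using (_∉_)
open import Data.Vec.Relation.Unary.Unique.Propositional using (Unique)
open import Function.Bundles using (_↔_; _↣_)
open import Relation.Binary.PropositionalEquality using (_≡_)
open import Relation.Nullary.Negation using (¬_)

-- Predicates are arbitrary Boolean functions: the size of the circuits
-- presenting them plays no role in the existence of solutions.
-- The bound `suc i < n` says `i ≤ n - 2`.
record Instance (n : ℕ) : Set₁ where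
  field
    U           : Set
    enumeration : Fin (2 ^ n ∸ 2) ↔ U
    repr        : U ↣ Vec Bool n
    P           : (i : ℕ) → .(suc i < n) → Vec U (2 + i) → Bool

module _ {n : ℕ} (I : Instance n) where
  open Instance I

  -- A sequence a₀, …, aₖ is a vector of length k + 1. The conditions
  -- involve Pᵢ for i < k only, so k ranges up to n - 1.
  IsSubcertificate : {k : ℕ} → k < n → Vec U (suc k) → Set
  IsSubcertificate {k} k<n a =
    Unique a ×
    ((i : ℕ) (i<k : i < k) (j : Fin (suc k)) → i < toℕ j →
      let prefix = truncate (s≤s (<⇒≤ i<k)) a
          Pᵢ     = P i (≤-trans (s≤s i<k) k<n)
      in Pᵢ (prefix ∷ʳ lookup a j) ≡ Pᵢ (prefix ∷ʳ lookup a (fromℕ< (s≤s i<k))))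

  Extends : {k : ℕ} → suc k < n → U → Vec U (suc k) → Set
  Extends k+1<n x a = x ∉ a × IsSubcertificate k+1<n (a ∷ʳ x)

  record Solution : Set where
    field
      k              : ℕ
      k+1<n          : suc k < n
      a              : Vec U (suc k)
      subcertificate : IsSubcertificate (<⇒≤ k+1<n) a
      c              : Bool
      no-extension   : ¬ (∃[ x ] Extends k+1<n x a × P k k+1<n (a ∷ʳ x) ≡ c)

{-# OPTIONS --safe #-}
-- Keep the set S of all elements extending a₀, …, aₖ. The less frequent value
-- of Pₖ(a₀, …, aₖ, ·) on S is taken at most ∣S∣ / 2 times: if never, it gives a
-- solution; otherwise some x ∈ S with this value becomes aₖ₊₁, and the
-- remaining elements of S with this value are exactly those extending
-- a₀, …, aₖ₊₁. The bound ∣S∣ + 3 ≤ 2 ^ (n - k), which holds for k = 0 since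
-- ∣S∣ = 2 ^ n - 3, is thereby preserved, and it is absurd for k = n - 1.
module Submission where

open import Data.Bool.Base using (Bool; true; false)
import Data.Bool.Properties as Bool
open import Data.Fin.Base using (Fin; zero; suc; toℕ; fromℕ; fromℕ<; inject₁)
open import Data.Fin.Properties as Fin
  using (toℕ-fromℕ; toℕ-fromℕ<; toℕ-inject₁; toℕ-injective; toℕ<n)
open import Data.Fin.Relation.Unary.Top using (view; ‵fromℕ; ‵inject₁)
open import Data.List.Base using (List; []; _∷_; length; filter)
import Data.List.Base as List
open import Data.List.Membership.Propositional using (_∈_)
open import Data.List.Membership.Propositional.Properties
  using (∈-filter⁺; ∈-filter⁻; ∈-tabulate⁺)
open import Data.List.Properties using (length-filter; length-tabulate)
open import Data.List.Relation.Unary.Any using (here; there)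
open import Data.Nat.Base
open import Data.Nat.Properties
open import Data.Product.Base using (_×_; _,_; ∃-syntax; proj₁; proj₂)
open import Data.Sum.Base using (_⊎_; inj₁; inj₂)
open import Data.Vec.Base as Vec using (Vec; lookup; truncate; _∷ʳ_)
import Data.Vec.Membership.Propositional as Vec
open import Data.Vec.Properties using (truncate-refl)
import Data.Vec.Relation.Unary.All as All
open import Data.Vec.Relation.Unary.AllPairs using ([]; _∷_)
import Data.Vec.Relation.Unary.Any as Any
open import Data.Vec.Relation.Unary.Unique.Propositional using (Unique)
open import Function.Base using (_∘_)
open import Function.Bundles using (_⇔_; mk⇔; module Equivalence; module Inverse)
open import Function.Construct.Symmetry using (↔-sym)
open import Function.Properties.Inverse using (↔⇒↣)
open import Relation.Binary.Definitions using (DecidableEquality)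
open import Relation.Binary.PropositionalEquality
open import Relation.Nullary.Decidable using (¬?; via-injection)
open import Relation.Nullary.Negation using (contradiction)
open import Defs

-- Appending an element to a vector.

module _ {A : Set} where

  -- The cut falls no later than the end of `xs`, so it never reaches `x`.
  truncate-∷ʳ : ∀ {m n} (m≤n : m ≤ n) (m≤1+n : m ≤ suc n) (xs : Vec A n) {x} →
                truncate m≤1+n (xs ∷ʳ x) ≡ truncate m≤n xs
  truncate-∷ʳ z≤n       z≤n         xs             = refl
  truncate-∷ʳ (s≤s m≤n) (s≤s m≤1+n) (y Vec.∷ xs) =
    cong (y Vec.∷_) (truncate-∷ʳ m≤n m≤1+n xs)

  lookup-∷ʳ-inject₁ : ∀ {n} (xs : Vec A n) {x} i →
                      lookup (xs ∷ʳ x) (inject₁ i) ≡ lookup xs i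
  lookup-∷ʳ-inject₁ (y Vec.∷ xs) zero    = refl
  lookup-∷ʳ-inject₁ (y Vec.∷ xs) (suc i) = lookup-∷ʳ-inject₁ xs i

  lookup-∷ʳ-fromℕ : ∀ {n} (xs : Vec A n) {x} → lookup (xs ∷ʳ x) (fromℕ n) ≡ x
  lookup-∷ʳ-fromℕ Vec.[]       = refl
  lookup-∷ʳ-fromℕ (y Vec.∷ xs) = lookup-∷ʳ-fromℕ xs

  ∈-∷ʳ⁺ˡ : ∀ {n} {xs : Vec A n} {x y} → y Vec.∈ xs → y Vec.∈ xs ∷ʳ x
  ∈-∷ʳ⁺ˡ (Any.here eq)  = Any.here eq
  ∈-∷ʳ⁺ˡ (Any.there y∈) = Any.there (∈-∷ʳ⁺ˡ y∈)

  ∈-∷ʳ⁺ʳ : ∀ {n} (xs : Vec A n) {x} → x Vec.∈ xs ∷ʳ x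
  ∈-∷ʳ⁺ʳ Vec.[]       = Any.here refl
  ∈-∷ʳ⁺ʳ (y Vec.∷ xs) = Any.there (∈-∷ʳ⁺ʳ xs)

  ∈-∷ʳ⁻ : ∀ {n} (xs : Vec A n) {x y} → y Vec.∈ xs ∷ʳ x → y Vec.∈ xs ⊎ y ≡ x
  ∈-∷ʳ⁻ Vec.[]       (Any.here eq)  = inj₂ eq
  ∈-∷ʳ⁻ (z Vec.∷ xs) (Any.here eq)  = inj₁ (Any.here eq)
  ∈-∷ʳ⁻ (z Vec.∷ xs) (Any.there y∈) with ∈-∷ʳ⁻ xs y∈
  ... | inj₁ y∈xs = inj₁ (Any.there y∈xs)
  ... | inj₂ eq   = inj₂ eq

  All-∷ʳ⁺ : ∀ {P : A → Set} {n} {xs : Vec A n} {x} →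
            All.All P xs → P x → All.All P (xs ∷ʳ x)
  All-∷ʳ⁺ All.[]         px = px All.∷ All.[]
  All-∷ʳ⁺ (py All.∷ pxs) px = py All.∷ All-∷ʳ⁺ pxs px

  Unique-∷ʳ⁺ : ∀ {n} {xs : Vec A n} {x} →
               Unique xs → x Vec.∉ xs → Unique (xs ∷ʳ x)
  Unique-∷ʳ⁺ []           x∉ = All.[] ∷ []
  Unique-∷ʳ⁺ (y∉xs ∷ xs!) x∉ =
    All-∷ʳ⁺ y∉xs (x∉ ∘ Any.here ∘ sym) ∷ Unique-∷ʳ⁺ xs! (x∉ ∘ Any.there)

  -- Counting the two values of a Boolean function.

  length-filter-true+false : (f : A → Bool) (xs : List A) →
    length (filter (λ x → f x Bool.≟ true) xs) +
    length (filter (λ x → f x Bool.≟ false) xs) ≡ length xs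
  length-filter-true+false f []       = refl
  length-filter-true+false f (x ∷ xs) with ih ← length-filter-true+false f xs | f x
  ... | true  = cong suc ih
  ... | false = trans (+-suc _ _) (cong suc ih)

  -- The two classes partition `xs`, so the smaller one has at most half its length.
  minority : (f : A → Bool) (xs : List A) →
             ∃[ c ] 2 * length (filter (λ x → f x Bool.≟ c) xs) ≤ length xs
  minority f xs = go (length-filter-true+false f xs)
    where
    #_ : Bool → ℕ
    # c = length (filter (λ x → f x Bool.≟ c) xs)

    go : # true + # false ≡ length xs → ∃[ c ] 2 * # c ≤ length xs
    go eq with ≤-total (# true) (# false)
    ... | inj₁ t≤f = true , (begin
      # true + (# true + 0) ≤⟨ +-monoʳ-≤ (# true) (≤-trans (≤-reflexive (+-identityʳ _)) t≤f) ⟩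
      # true + # false      ≡⟨ eq ⟩
      length xs             ∎) where open ≤-Reasoning
    ... | inj₂ f≤t = false , (begin
      # false + (# false + 0) ≤⟨ +-mono-≤ f≤t (≤-reflexive (+-identityʳ _)) ⟩
      # true + # false        ≡⟨ eq ⟩
      length xs               ∎) where open ≤-Reasoning

-- Here `2 * (m + 1) ≤ s + 2 < 2 * N`, hence `m + 1 < N`. The slack 3 recurs: once one of the `m`
-- survivors is chosen, `m - 1` are left, and `(m - 1) + 3 = m + 2`.
halve-bound : ∀ {m s N} → 2 * m ≤ s → s + 3 ≤ 2 * N → m + 2 ≤ N
halve-bound {m} {s} {N} 2m≤s s+3≤2N = begin
  m + 2     ≡⟨ +-comm m 2 ⟩
  2 + m     ≡⟨ cong suc (+-comm 1 m) ⟩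
  suc (m + 1) ≤⟨ *-cancelˡ-< 2 (m + 1) N (begin-strict
    2 * (m + 1)   ≡⟨ *-distribˡ-+ 2 m 1 ⟩
    2 * m + 2     ≤⟨ +-monoˡ-≤ 2 2m≤s ⟩
    s + 2         <⟨ +-monoʳ-< s (n<1+n 2) ⟩
    s + 3         ≤⟨ s+3≤2N ⟩
    2 * N         ∎) ⟩
  N ∎ where open ≤-Reasoning

-- How the constraints change when an element is appended.

module _ {n : ℕ} (I : Instance n) where
  open Instance I

  answer : ∀ {k} → .(k < n) → Vec U (suc k) → ∀ {i} → i < k → U → Bool
  answer k<n a {i} i<k y =
    P i (≤-trans (s≤s i<k) k<n) (truncate (s≤s (<⇒≤ i<k)) a ∷ʳ y)

  pivot : ∀ {k} → Vec U (suc k) → ∀ {i} → i < k → U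
  pivot a i<k = lookup a (fromℕ< (s≤s i<k))

  -- For a subcertificate `a` with `suc k < n` this is equivalent to `Extends`, but it needs only
  -- `k < n`: the search also describes its candidates at `k = n - 1`, where no predicate `P k`
  -- exists.
  Compatible : ∀ {k} → .(k < n) → Vec U (suc k) → U → Set
  Compatible {k} k<n a y =
    y Vec.∉ a ×
    (∀ {i} (i<k : i < k) → answer k<n a i<k y ≡ answer k<n a i<k (pivot a i<k))

  module _ {k : ℕ} .(k+1<n : suc k < n) (a : Vec U (suc k)) {x : U} where

    -- For `i < k` the prefix ends before `x`. The two bounds are separate arguments, so that no
    -- caller has to relate their proofs.
    answer-∷ʳ-< : ∀ {i} (i<1+k : i < suc k) (i<k : i < k) y →
                  answer k+1<n (a ∷ʳ x) i<1+k y ≡ answer (<⇒≤ k+1<n) a i<k y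
    answer-∷ʳ-< {i} i<1+k i<k y =
      cong (λ p → P i (≤-trans (s≤s i<1+k) k+1<n) (p ∷ʳ y)) (truncate-∷ʳ (s≤s (<⇒≤ i<k)) _ a)

    -- At `i = k` the prefix is all of `a`; this is the one new constraint, and its pivot is `x`
    -- itself.
    answer-∷ʳ-last : (k<1+k : k < suc k) → ∀ y →
                     answer k+1<n (a ∷ʳ x) k<1+k y ≡ P k k+1<n (a ∷ʳ y)
    answer-∷ʳ-last k<1+k y =
      cong (λ p → P k k+1<n (p ∷ʳ y))
        (trans (truncate-∷ʳ ≤-refl _ a) (truncate-refl a))

    pivot-∷ʳ-< : ∀ {i} (i<1+k : i < suc k) (i<k : i < k) →
                 pivot (a ∷ʳ x) i<1+k ≡ pivot a i<k
    pivot-∷ʳ-< {i} i<1+k i<k =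
      trans (cong (lookup (a ∷ʳ x)) (toℕ-injective same-index))
            (lookup-∷ʳ-inject₁ a (fromℕ< (s≤s i<k)))
      where
      same-index : toℕ (fromℕ< (s≤s i<1+k)) ≡ toℕ (inject₁ (fromℕ< (s≤s i<k)))
      same-index = trans (toℕ-fromℕ< (s≤s i<1+k))
        (sym (trans (toℕ-inject₁ (fromℕ< (s≤s i<k))) (toℕ-fromℕ< (s≤s i<k))))

    pivot-∷ʳ-last : (k<1+k : k < suc k) → pivot (a ∷ʳ x) k<1+k ≡ x
    pivot-∷ʳ-last k<1+k =
      trans (cong (lookup (a ∷ʳ x)) (sym (Fin.fromℕ-def (suc k)))) (lookup-∷ʳ-fromℕ a)

    pivot-answer-∷ʳ-< : ∀ {i} (i<1+k : i < suc k) (i<k : i < k) →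
      answer k+1<n (a ∷ʳ x) i<1+k (pivot (a ∷ʳ x) i<1+k) ≡
      answer (<⇒≤ k+1<n) a i<k (pivot a i<k)
    pivot-answer-∷ʳ-< i<1+k i<k =
      trans (answer-∷ʳ-< i<1+k i<k _)
            (cong (answer (<⇒≤ k+1<n) a i<k) (pivot-∷ʳ-< i<1+k i<k))

    pivot-answer-∷ʳ-last : (k<1+k : k < suc k) →
      answer k+1<n (a ∷ʳ x) k<1+k (pivot (a ∷ʳ x) k<1+k) ≡ P k k+1<n (a ∷ʳ x)
    pivot-answer-∷ʳ-last k<1+k =
      trans (answer-∷ʳ-last k<1+k _)
            (cong (λ z → P k k+1<n (a ∷ʳ z)) (pivot-∷ʳ-last k<1+k))

    -- Old indices keep their constraints, and the index `k` contributes `same`. Together with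
    -- `Compatible-∷ʳ⁻` this shows that choosing `x` keeps exactly the other candidates on which
    -- `P k` takes the value it has at `x`.
    Compatible-∷ʳ⁺ : ∀ {y} → Compatible (<⇒≤ k+1<n) a y → y ≢ x →
                     P k k+1<n (a ∷ʳ y) ≡ P k k+1<n (a ∷ʳ x) →
                     Compatible k+1<n (a ∷ʳ x) y
    Compatible-∷ʳ⁺ {y} (y∉a , agree) y≢x same = y∉ , agree′
      where
      y∉ : y Vec.∉ a ∷ʳ x
      y∉ y∈ with ∈-∷ʳ⁻ a y∈
      ... | inj₁ y∈a = y∉a y∈a
      ... | inj₂ y≡x = y≢x y≡x

      agree′ : ∀ {i} (i<1+k : i < suc k) →
               answer k+1<n (a ∷ʳ x) i<1+k y ≡
               answer k+1<n (a ∷ʳ x) i<1+k (pivot (a ∷ʳ x) i<1+k)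
      agree′ i<1+k with m≤n⇒m<n∨m≡n (s≤s⁻¹ i<1+k)
      ... | inj₁ i<k  = trans (answer-∷ʳ-< i<1+k i<k y)
                          (trans (agree i<k) (sym (pivot-answer-∷ʳ-< i<1+k i<k)))
      ... | inj₂ refl = trans (answer-∷ʳ-last i<1+k y)
                          (trans same (sym (pivot-answer-∷ʳ-last i<1+k)))

    Compatible-∷ʳ⁻ : ∀ {y} → Compatible k+1<n (a ∷ʳ x) y →
                     Compatible (<⇒≤ k+1<n) a y × y ≢ x ×
                     P k k+1<n (a ∷ʳ y) ≡ P k k+1<n (a ∷ʳ x)
    Compatible-∷ʳ⁻ {y} (y∉ , agree) =
      (y∉ ∘ ∈-∷ʳ⁺ˡ ,
       λ i<k → trans (sym (answer-∷ʳ-< (m<n⇒m<1+n i<k) i<k y))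
                 (trans (agree (m<n⇒m<1+n i<k))
                        (pivot-answer-∷ʳ-< (m<n⇒m<1+n i<k) i<k))) ,
      (λ { refl → y∉ (∈-∷ʳ⁺ʳ a) }) ,
      trans (sym (answer-∷ʳ-last ≤-refl y))
        (trans (agree ≤-refl) (pivot-answer-∷ʳ-last ≤-refl))

  module _ {k : ℕ} (k+1<n : suc k < n) (a : Vec U (suc k)) {x : U} where

    IsSubcertificate-∷ʳ⁺ : IsSubcertificate I (<⇒≤ k+1<n) a →
                           Compatible (<⇒≤ k+1<n) a x →
                           IsSubcertificate I k+1<n (a ∷ʳ x)
    IsSubcertificate-∷ʳ⁺ (a! , cert) (x∉a , agree) = Unique-∷ʳ⁺ a! x∉a , cert′
      where
      cert′ : ∀ i (i<1+k : i < suc k) (j : Fin (2 + k)) → i < toℕ j →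
              answer k+1<n (a ∷ʳ x) i<1+k (lookup (a ∷ʳ x) j) ≡
              answer k+1<n (a ∷ʳ x) i<1+k (pivot (a ∷ʳ x) i<1+k)
      cert′ i i<1+k j i<j with m≤n⇒m<n∨m≡n (s≤s⁻¹ i<1+k)
      -- Now `k < toℕ j ≤ k + 1`, so `j` is the position of the pivot itself.
      ... | inj₂ refl = cong (answer k+1<n (a ∷ʳ x) i<1+k ∘ lookup (a ∷ʳ x))
        (toℕ-injective (trans (≤-antisym (s≤s⁻¹ (toℕ<n j)) i<j)
                              (sym (toℕ-fromℕ< (s≤s i<1+k)))))
      ... | inj₁ i<k = begin
        answer k+1<n (a ∷ʳ x) i<1+k (lookup (a ∷ʳ x) j)
          ≡⟨ answer-∷ʳ-< k+1<n a i<1+k i<k _ ⟩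
        answer (<⇒≤ k+1<n) a i<k (lookup (a ∷ʳ x) j)
          ≡⟨ agree-at j i<j ⟩
        answer (<⇒≤ k+1<n) a i<k (pivot a i<k)
          ≡⟨ pivot-answer-∷ʳ-< k+1<n a i<1+k i<k ⟨
        answer k+1<n (a ∷ʳ x) i<1+k (pivot (a ∷ʳ x) i<1+k) ∎
        where
        open ≡-Reasoning
        agree-at : ∀ j → i < toℕ j →
                   answer (<⇒≤ k+1<n) a i<k (lookup (a ∷ʳ x) j) ≡
                   answer (<⇒≤ k+1<n) a i<k (pivot a i<k)
        -- The last position holds `x`, which is covered by compatibility; every other one is
        -- covered by the certificate for `a`.
        agree-at j i<j with view j
        ... | ‵fromℕ     = trans (cong (answer (<⇒≤ k+1<n) a i<k) (lookup-∷ʳ-fromℕ a)) (agree i<k)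
        ... | ‵inject₁ l = trans (cong (answer (<⇒≤ k+1<n) a i<k) (lookup-∷ʳ-inject₁ a l))
                             (cert i i<k l (subst (i <_) (toℕ-inject₁ l) i<j))

    -- This is the subcertificate condition of `a ∷ʳ x` with `j` the last position.
    Extends⇒Compatible : Extends I k+1<n x a → Compatible (<⇒≤ k+1<n) a x
    Extends⇒Compatible (x∉a , (_ , cert)) = x∉a , λ {i} i<k →
      let i<1+k = m<n⇒m<1+n i<k in begin
        answer (<⇒≤ k+1<n) a i<k x
          ≡⟨ answer-∷ʳ-< k+1<n a i<1+k i<k x ⟨
        answer k+1<n (a ∷ʳ x) i<1+k x
          ≡⟨ cong (answer k+1<n (a ∷ʳ x) i<1+k) (lookup-∷ʳ-fromℕ a) ⟨
        answer k+1<n (a ∷ʳ x) i<1+k (lookup (a ∷ʳ x) (fromℕ (suc k)))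
          ≡⟨ cert i i<1+k (fromℕ (suc k)) (subst (i <_) (sym (toℕ-fromℕ (suc k))) i<1+k) ⟩
        answer k+1<n (a ∷ʳ x) i<1+k (pivot (a ∷ʳ x) i<1+k)
          ≡⟨ pivot-answer-∷ʳ-< k+1<n a i<1+k i<k ⟩
        answer (<⇒≤ k+1<n) a i<k (pivot a i<k) ∎
      where open ≡-Reasoning

  -- The halving search.

  _≟ᵁ_ : DecidableEquality U
  _≟ᵁ_ = via-injection (↔⇒↣ (↔-sym enumeration)) Fin._≟_

  module _ {k : ℕ} (k+1<n : suc k < n) (a : Vec U (suc k)) (S : List U)
           (S-exact : ∀ y → Compatible (<⇒≤ k+1<n) a y ⇔ y ∈ S) where

    class : Bool → List U
    class c = filter (λ y → P k k+1<n (a ∷ʳ y) Bool.≟ c) S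

    -- An extension with value `c` would be compatible, hence in `S`, hence in the empty class.
    class-empty⇒solution : ∀ c → IsSubcertificate I (<⇒≤ k+1<n) a →
                           class c ≡ [] → Solution I
    class-empty⇒solution c cert empty = record
      { k = k ; k+1<n = k+1<n ; a = a ; subcertificate = cert ; c = c
      ; no-extension = λ (x , x-ext , Px≡c) →
          let x∈S = Equivalence.to (S-exact x) (Extends⇒Compatible k+1<n a x-ext)
          in ∉[] (subst (x ∈_) empty
                   (∈-filter⁺ (λ y → P k k+1<n (a ∷ʳ y) Bool.≟ c) x∈S Px≡c))
      }
      where
      ∉[] : ∀ {x : U} {B : Set} → x ∈ [] → B
      ∉[] ()

    -- All members of the class share the value `c` with `x`, which settles the new constraint. The
    -- filter also drops further copies of `x` from `T`, so `S` may contain repetitions.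
    class-next : ∀ {c x T} → class c ≡ x ∷ T →
                 Compatible (<⇒≤ k+1<n) a x ×
                 (∀ y → Compatible k+1<n (a ∷ʳ x) y ⇔
                        y ∈ filter (λ z → ¬? (z ≟ᵁ x)) T)
    class-next {c} {x} {T} eq =
      proj₁ (member (here refl)) , λ y → mk⇔ (to y) (from y)
      where
      P? = λ y → P k k+1<n (a ∷ʳ y) Bool.≟ c

      member : ∀ {y} → y ∈ x ∷ T →
               Compatible (<⇒≤ k+1<n) a y × P k k+1<n (a ∷ʳ y) ≡ c
      member {y} y∈ =
        let y∈S , Py≡c = ∈-filter⁻ P? {xs = S} (subst (y ∈_) (sym eq) y∈)
        in Equivalence.from (S-exact y) y∈S , Py≡c

      to : ∀ y → Compatible k+1<n (a ∷ʳ x) y → y ∈ filter (λ z → ¬? (z ≟ᵁ x)) T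
      to y y-comp
        with y-comp′ , y≢x , same ← Compatible-∷ʳ⁻ k+1<n a y-comp
        with subst (y ∈_) eq (∈-filter⁺ P? (Equivalence.to (S-exact y) y-comp′)
                                (trans same (proj₂ (member (here refl)))))
      ... | here y≡x  = contradiction y≡x y≢x
      ... | there y∈T = ∈-filter⁺ (λ z → ¬? (z ≟ᵁ x)) y∈T y≢x

      from : ∀ y → y ∈ filter (λ z → ¬? (z ≟ᵁ x)) T → Compatible k+1<n (a ∷ʳ x) y
      from y y∈ =
        let y∈T , y≢x     = ∈-filter⁻ (λ z → ¬? (z ≟ᵁ x)) {xs = T} y∈
            y-comp , Py≡c = member (there y∈T)
        in Compatible-∷ʳ⁺ k+1<n a y-comp y≢x
             (trans Py≡c (sym (proj₂ (member (here refl)))))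

  -- Induction on `r = n - 1 - k`, the number of elements that can still be appended; `2 ^ suc r` is
  -- thus `2 ^ (n - k)`.
  search : ∀ r {k} (k<n : k < n) → suc k + r ≡ n →
           (a : Vec U (suc k)) → IsSubcertificate I k<n a →
           (S : List U) → (∀ y → Compatible k<n a y ⇔ y ∈ S) →
           length S + 3 ≤ 2 ^ suc r → Solution I
  search zero _ _ _ _ S _ bound =
    -- With `k = n - 1` the bound would give `3 ≤ 2`.
    contradiction (≤-trans (m≤n+m 3 (length S)) bound) (λ { (s≤s (s≤s ())) })
  search (suc r) {k} _ eq a cert S S-exact bound = go (class k+1<n a S S-exact c) refl
    where
    eq′ : suc (suc k) + r ≡ n
    eq′ = trans (sym (+-suc (suc k) r)) eq

    k+1<n : suc k < n
    k+1<n = subst (suc k <_) eq′ (m≤m+n (suc (suc k)) r)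

    small = minority (λ y → P k k+1<n (a ∷ʳ y)) S
    c     = proj₁ small

    -- Matching on a variable `C` retains its equation with the class, which both cases use.
    go : ∀ C → class k+1<n a S S-exact c ≡ C → Solution I
    go []      empty = class-empty⇒solution k+1<n a S S-exact c cert empty
    go (x ∷ T) C≡x∷T =
      let x-comp , exact′ = class-next k+1<n a S S-exact C≡x∷T
      in search r k+1<n eq′ (a ∷ʳ x) (IsSubcertificate-∷ʳ⁺ k+1<n a cert x-comp)
           (filter (λ z → ¬? (z ≟ᵁ x)) T) exact′ (begin
             length (filter (λ z → ¬? (z ≟ᵁ x)) T) + 3
               ≤⟨ +-monoˡ-≤ 3 (length-filter (λ z → ¬? (z ≟ᵁ x)) T) ⟩
             length T + 3
               -- Counting `x` again turns the slack 3 into the 2 that `halve-bound` supplies.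
               ≡⟨ +-suc (length T) 2 ⟩
             length (x ∷ T) + 2
               ≡⟨ cong (λ C → length C + 2) C≡x∷T ⟨
             length (class k+1<n a S S-exact c) + 2
               ≤⟨ halve-bound (proj₂ small) bound ⟩
             2 ^ suc r ∎)
      where open ≤-Reasoning

  -- The initial candidates.

  elements : List U
  elements = List.tabulate (Inverse.to enumeration)

  ∈-elements : ∀ y → y ∈ elements
  ∈-elements y = subst (_∈ elements) (Inverse.strictlyInverseˡ enumeration y)
    (∈-tabulate⁺ {f = Inverse.to enumeration} (Inverse.from enumeration y))

  -- At `k = 0` there is no index below `k`, so only distinctness from `x` remains.
  Compatible-[-]⇔ : .(0<n : 0 < n) → ∀ x T → elements ≡ x ∷ T → ∀ y →
    Compatible 0<n (x Vec.∷ Vec.[]) y ⇔ y ∈ filter (λ z → ¬? (z ≟ᵁ x)) T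
  Compatible-[-]⇔ 0<n x T eq y = mk⇔ to from
    where
    to : Compatible 0<n (x Vec.∷ Vec.[]) y → y ∈ filter (λ z → ¬? (z ≟ᵁ x)) T
    to (y∉ , _) with subst (y ∈_) eq (∈-elements y)
    ... | here y≡x  = contradiction (Any.here y≡x) y∉
    ... | there y∈T = ∈-filter⁺ (λ z → ¬? (z ≟ᵁ x)) y∈T (y∉ ∘ Any.here)

    from : y ∈ filter (λ z → ¬? (z ≟ᵁ x)) T → Compatible 0<n (x Vec.∷ Vec.[]) y
    from y∈ =
      (λ { (Any.here y≡x) → proj₂ (∈-filter⁻ (λ z → ¬? (z ≟ᵁ x)) {xs = T} y∈) y≡x }) ,
      λ ()

theorem6 : (n : ℕ) → 2 ≤ n → (I : Instance n) → Solution I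
theorem6 n@(suc (suc m)) (s≤s (s≤s _)) I = start (elements I) refl
  where
  open Instance I

  -- This makes `2 ^ n ∸ 2` a genuine subtraction and the universe non-empty.
  4≤2^n : 4 ≤ 2 ^ n
  4≤2^n = ^-monoʳ-≤ 2 {2} {n} (s≤s (s≤s z≤n))

  length+2 : length (elements I) + 2 ≡ 2 ^ n
  length+2 = trans (cong (_+ 2) (length-tabulate (Inverse.to enumeration)))
                   (m∸n+n≡m (≤-trans (s≤s (s≤s z≤n)) 4≤2^n))

  start : ∀ E → elements I ≡ E → Solution I
  start [] eq =
    contradiction (subst (4 ≤_) (trans (sym length+2) (cong (λ E → length E + 2) eq)) 4≤2^n)
                  (λ { (s≤s (s≤s ())) })
  start (x ∷ T) eq =
    -- Here `suc m` is `n - 1`. Setting `x` aside from the `2 ^ n ∸ 2` elements leaves exactly the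
    -- slack 3.
    search I (suc m) (s≤s z≤n) refl (x Vec.∷ Vec.[]) (All.[] ∷ [] , λ _ ())
      (filter (λ z → ¬? (_≟ᵁ_ I z x)) T) (Compatible-[-]⇔ I (s≤s z≤n) x T eq) (begin
        length (filter (λ z → ¬? (_≟ᵁ_ I z x)) T) + 3
          ≤⟨ +-monoˡ-≤ 3 (length-filter (λ z → ¬? (_≟ᵁ_ I z x)) T) ⟩
        length T + 3          ≡⟨ +-suc (length T) 2 ⟩
        length (x ∷ T) + 2    ≡⟨ cong (λ E → length E + 2) eq ⟨
        length (elements I) + 2 ≡⟨ length+2 ⟩
        2 ^ n                 ∎)
    where open ≤-Reasoning
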